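{- Let $G$ be a connected graph and let $v\in V(G)$ be a cut-vertex such that either (1) $G-v$ has at least three connected components, or (2) $G-v$ has two connected components $G_1,G_2$ such that, for both $i=1,2$, the induced subgraph $G[V(G_i)\cup\{v\}]$ is not isomorphic to a path. Then $v$ is a void vertex of $G$.
   Context: All graphs are finite and simple. For vertices $u,v$ of a connected graph $G$, $d(u,v)$ is the length of a shortest $u$–$v$ path. A set $R\subseteq V(G)$ is a resolving set if for all distinct $x,y\in V(G)$ there is $r\in R$ with $d(r,x)\neq d(r,y)$. The metric dimension $\dim(G)$ is the minimum cardinality of a resolving set, and a resolving set of cardinality $\dim(G)$ is a metric basis. A vertex is a void vertex if it belongs to no metric basis of $G$. A cut-vertex is a vertex $v$ such that $G-v$ is disconnected; $G[S]$ denotes the subgraph induced by $S$. -}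

module Defs where

open import Data.Fin using (Fin; toℕ)
open import Data.Fin.Subset using (Subset; _∈_; _∉_; _⊆_; _∪_; ∁; ⁅_⁆; ∣_∣; Nonempty)
open import Data.List using (List; []; _∷_)
open import Data.List.Relation.Unary.Unique.Propositional using (Unique)
open import Data.Nat using (ℕ; zero; suc; _≤_)
open import Data.Nat.Properties using (_≟_; 1+n≢n)
open import Data.Product using (Σ; ∃; _×_; _,_; proj₁)
open import Data.Sum using (_⊎_; inj₁; inj₂; swap)
open import Function.Bundles using (_↔_; _⇔_; Inverse)
open import Relation.Binary.PropositionalEquality using (_≡_; _≢_; sym)
open import Relation.Nullary using (¬_; Dec)
open import Relation.Nullary.Decidable using (_⊎-dec_)

-- Simple graphs on a vertex type V; the finite graphs are those on Fin n.
record Graph (V : Set) : Set₁ where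
  field
    Adj        : V → V → Set
    adj?       : ∀ u w → Dec (Adj u w)
    adj-sym    : ∀ {u w} → Adj u w → Adj w u
    adj-irrefl : ∀ {u} → ¬ Adj u u

open Graph public

record _≅_ {V W : Set} (G : Graph V) (H : Graph W) : Set where
  field
    bijection : V ↔ W
    preserves : ∀ u w → Adj G u w ⇔ Adj H (Inverse.to bijection u) (Inverse.to bijection w)

-- Indexed by the number of edges, so that a path has at least one vertex.
pathGraph : (k : ℕ) → Graph (Fin (suc k))
pathGraph k = record
  { Adj        = λ i j → toℕ j ≡ suc (toℕ i) ⊎ toℕ i ≡ suc (toℕ j)
  ; adj?       = λ i j → (toℕ j ≟ suc (toℕ i)) ⊎-dec (toℕ i ≟ suc (toℕ j))
  ; adj-sym    = swap
  ; adj-irrefl = λ { (inj₁ e) → 1+n≢n (sym e) ; (inj₂ e) → 1+n≢n (sym e) }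
  }

IsomorphicToPath : {V : Set} → Graph V → Set
IsomorphicToPath G = ∃ λ k → G ≅ pathGraph k

data Walk {V : Set} (G : Graph V) : V → V → Set where
  stop : ∀ {u} → Walk G u u
  step : ∀ {u x w} → Adj G u x → Walk G x w → Walk G u w

module _ {V : Set} {G : Graph V} where

  walkLength : ∀ {u w} → Walk G u w → ℕ
  walkLength stop       = zero
  walkLength (step _ p) = suc (walkLength p)

  walkVertices : ∀ {u w} → Walk G u w → List V
  walkVertices {u} stop       = u ∷ []
  walkVertices {u} (step _ p) = u ∷ walkVertices p

Path : {V : Set} (G : Graph V) → V → V → Set
Path G u w = Σ (Walk G u w) λ p → Unique (walkVertices p)

pathLength : {V : Set} {G : Graph V} {u w : V} → Path G u w → ℕ
pathLength (p , _) = walkLength p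

-- The null graph counts as connected; consequently the vertex of the
-- one-vertex graph is not a cut-vertex.
Connected : {V : Set} → Graph V → Set
Connected G = ∀ u w → Path G u w

-- IsDistance G u w k says d(u,w) = k.
IsDistance : {V : Set} (G : Graph V) → V → V → ℕ → Set
IsDistance G u w k = (∃ λ (p : Path G u w) → pathLength p ≡ k) × (∀ (q : Path G u w) → k ≤ pathLength q)

module _ {n : ℕ} (G : Graph (Fin n)) where

  -- d(r,x) ≠ d(r,y); in a connected graph the distances k and l exist and are unique.
  Resolves : Fin n → Fin n → Fin n → Set
  Resolves r x y = ∃ λ k → ∃ λ l → IsDistance G r x k × IsDistance G r y l × k ≢ l

  IsResolvingSet : Subset n → Set
  IsResolvingSet R = ∀ x y → x ≢ y → ∃ λ r → r ∈ R × Resolves r x y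

  -- IsMetricDimension k says dim(G) = k.
  IsMetricDimension : ℕ → Set
  IsMetricDimension k =
    (∃ λ R → IsResolvingSet R × ∣ R ∣ ≡ k) × (∀ R → IsResolvingSet R → k ≤ ∣ R ∣)

  IsMetricBasis : Subset n → Set
  IsMetricBasis R = IsResolvingSet R × IsMetricDimension ∣ R ∣

  IsVoidVertex : Fin n → Set
  IsVoidVertex v = ∀ R → IsMetricBasis R → v ∉ R

  -- G[S]; membership in a Subset is proof-irrelevant, so the vertices of
  -- G[S] are exactly the elements of S.
  induced : (S : Subset n) → Graph (∃ λ x → x ∈ S)
  induced S = record
    { Adj        = λ u w → Adj G (proj₁ u) (proj₁ w)
    ; adj?       = λ u w → adj? G (proj₁ u) (proj₁ w)
    ; adj-sym    = adj-sym G
    ; adj-irrefl = adj-irrefl G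
    }

  delete : (v : Fin n) → Graph (∃ λ x → x ∈ ∁ ⁅ v ⁆)
  delete v = induced (∁ ⁅ v ⁆)

  IsCutVertex : Fin n → Set
  IsCutVertex v = ¬ Connected (delete v)

  -- C is the vertex set of a connected component (a maximal connected
  -- subgraph) of G[S].  Since (G[S])[C] = G[C] for C ⊆ S, connectedness is
  -- expressed in G[C].
  IsComponentOfInduced : Subset n → Subset n → Set
  IsComponentOfInduced S C =
    C ⊆ S × Nonempty C × Connected (induced C) ×
    (∀ D → D ⊆ S → C ⊆ D → Connected (induced D) → D ⊆ C)

  -- C is the vertex set of a connected component of G - v.
  IsComponentOfDelete : Fin n → Subset n → Set
  IsComponentOfDelete v = IsComponentOfInduced (∁ ⁅ v ⁆)

  AtLeastThreeComponents : Fin n → Set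
  AtLeastThreeComponents v =
    ∃ λ C₁ → ∃ λ C₂ → ∃ λ C₃ →
      IsComponentOfDelete v C₁ × IsComponentOfDelete v C₂ × IsComponentOfDelete v C₃ ×
      C₁ ≢ C₂ × C₁ ≢ C₃ × C₂ ≢ C₃

  -- C₁ and C₂ are the vertex sets of the components of G - v, and there are exactly two.
  AreTheTwoComponents : Fin n → Subset n → Subset n → Set
  AreTheTwoComponents v C₁ C₂ =
    IsComponentOfDelete v C₁ × IsComponentOfDelete v C₂ × C₁ ≢ C₂ ×
    (∀ C → IsComponentOfDelete v C → C ≡ C₁ ⊎ C ≡ C₂)

  TwoNonPathComponents : Fin n → Set
  TwoNonPathComponents v =
    ∃ λ C₁ → ∃ λ C₂ → AreTheTwoComponents v C₁ C₂ ×
      ¬ IsomorphicToPath (induced (C₁ ∪ ⁅ v ⁆)) × ¬ IsomorphicToPath (induced (C₂ ∪ ⁅ v ⁆))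

{-# OPTIONS --safe #-}

-- If v lies in a resolving set R, then R - v still resolves whenever R meets
-- two components A and B of G - v, at a and b say: every vertex x lies
-- outside A or outside B, so d(a,x) = d(a,v) + d(v,x) or d(b,x) = d(b,v) + d(v,x),
-- and hence a pair resolved by v is resolved by a or by b.  If R misses a component
-- C, then on C ∪ {v} every r ∈ R sees only the distance to v, so these distances
-- are pairwise distinct and the breadth-first layers of G[C ∪ {v}] from v are
-- singletons, that is, G[C ∪ {v}] is a path.  For the same reason R cannot miss
-- two components, since v has a neighbour in each of them.
module Submission where

open import Data.Empty using (⊥; ⊥-elim)
open import Data.Fin using (Fin; zero; suc; toℕ; fromℕ<)
open import Data.Fin.Properties using (any?; toℕ-fromℕ<; toℕ-injective; toℕ<n) renaming (_≟_ to _≟ᶠ_)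
open import Data.Fin.Subset using (Subset; _∈_; _∉_; _⊆_; _∪_; _-_; ∁; ⁅_⁆)
open import Data.Fin.Subset.Properties using (_∈?_; x∈⁅x⁆; x∈⁅y⁆⇒x≡y; x∈∁p⇒x∉p; x∉p⇒x∈∁p; x∈p∪q⁻; p⊆p∪q; q⊆p∪q; ⊆-antisym; x∈p⇒∣p-x∣<∣p∣; x∈p∧x≢y⇒x∈p-y)
open import Data.List.Membership.DecPropositional as ListMembership using ()
open import Data.List.Membership.Propositional using () renaming (_∈_ to _∈ˡ_)
open import Data.List.Relation.Unary.All using ([])
open import Data.List.Relation.Unary.All.Properties using (¬Any⇒All¬)
open import Data.List.Relation.Unary.AllPairs using ([]; _∷_)
open import Data.List.Relation.Unary.Any using (here; there)
open import Data.Nat using (ℕ; zero; suc; _+_; _≤_; _<_; _⊔_; z≤n; s≤s)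
open import Data.Nat.Properties using (_≟_; ≤-refl; ≤-reflexive; ≤-trans; ≤-antisym; ≤-pred; m≤n⇒m≤1+n; m≤n⇒m<n∨m≡n; m≤m⊔n; m≤n⊔m; +-comm; +-identityʳ; +-mono-≤; +-cancelˡ-≤; 1+n≰n; ≰⇒>; n≤0⇒n≡0; suc-injective; module ≤-Reasoning)
open import Data.Product using (∃; _×_; _,_; proj₁; proj₂)
open import Data.Sum using (_⊎_; inj₁; inj₂)
open import Data.Vec.Properties.WithK using ([]=-irrelevant)
open import Function using (_∘_)
open import Function.Bundles using (mk↔ₛ′; mk⇔)
open import Relation.Binary.Definitions using (DecidableEquality)
open import Relation.Binary.PropositionalEquality using (_≡_; _≢_; refl; sym; trans; cong; subst)
open import Relation.Nullary using (¬_; Dec; yes; no; contradiction)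
open import Relation.Nullary.Decidable using (_×-dec_; ¬?; decidable-stable; map′)
open import Defs

-- Bounded search for least elements, and bounds on finite domains.

leastWitness : {P : ℕ → Set} → (∀ k → Dec (P k)) → ∀ N → P N →
  ∃ λ k → P k × (∀ j → P j → k ≤ j)
leastWitness P? zero    p = 0 , p , λ _ _ → z≤n
leastWitness P? (suc N) p with P? 0
... | yes p₀ = 0 , p₀ , λ _ _ → z≤n
... | no ¬p₀ with leastWitness (P? ∘ suc) N p
...   | k , pk , least = suc k , pk ,
        λ { zero p₀ → contradiction p₀ ¬p₀ ; (suc j) pj → s≤s (least j pj) }

bounded : ∀ {n} (f : Fin n → ℕ) → ∃ λ B → ∀ x → f x ≤ B
bounded {zero}  f = 0 , λ ()
bounded {suc n} f with bounded (f ∘ suc)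
... | B , f≤B = f zero ⊔ B , λ where
  zero    → m≤m⊔n (f zero) B
  (suc x) → ≤-trans (f≤B x) (m≤n⊔m (f zero) B)

-- Walks and their reduction to paths.

module _ {V : Set} {G : Graph V} where

  append : ∀ {u x w} (p : Walk G u x) (q : Walk G x w) →
    ∃ λ (r : Walk G u w) → walkLength r ≡ walkLength p + walkLength q
  append stop       q = q , refl
  append (step e p) q with append p q
  ... | r , eq = step e r , cong suc eq

  reverse : ∀ {u w} (p : Walk G u w) → ∃ λ (q : Walk G w u) → walkLength q ≡ walkLength p
  reverse stop = stop , refl
  reverse (step e p) with reverse p
  ... | q , eq with append q (step (adj-sym G e) stop)
  ...   | r , eq′ = r , trans eq′ (trans (+-comm _ 1) (cong suc eq))

  suffix : ∀ {u x w} (p : Path G x w) → u ∈ˡ walkVertices (proj₁ p) →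
    ∃ λ (q : Path G u w) → pathLength q ≤ pathLength p
  suffix p@(stop , _)         (here refl) = p , ≤-refl
  suffix p@(step _ _ , _)     (here refl) = p , ≤-refl
  suffix (step _ p , _ ∷ uniq) (there u∈p) with suffix (p , uniq) u∈p
  ... | q , q≤p = q , m≤n⇒m≤1+n q≤p

  -- The tail is shortened first; if the new starting vertex occurs on it, `suffix` drops the closed
  -- detour. This lets walks, which concatenate freely, stand in for paths.
  shorten : DecidableEquality V → ∀ {u w} (p : Walk G u w) →
    ∃ λ (q : Path G u w) → pathLength q ≤ walkLength p
  shorten _≟ⱽ_ stop = (stop , [] ∷ []) , z≤n
  shorten _≟ⱽ_ {u} (step e p) with shorten _≟ⱽ_ p
  ... | q , q≤p with ListMembership._∈?_ _≟ⱽ_ u (walkVertices (proj₁ q))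
  ...   | yes u∈q = let (r , r≤q) = suffix q u∈q in r , m≤n⇒m≤1+n (≤-trans r≤q q≤p)
  ...   | no  u∉q = (step e (proj₁ q) , ¬Any⇒All¬ _ u∉q ∷ proj₂ q) , s≤s q≤p

-- Induced subgraphs and bounded walks.

module _ {n : ℕ} where

  Element : Subset n → Set
  Element S = ∃ λ x → x ∈ S

  element-≡ : ∀ {S} {u w : Element S} → proj₁ u ≡ proj₁ w → u ≡ w
  element-≡ {u = x , p} {w = .x , q} refl = cong (x ,_) ([]=-irrelevant p q)

  _≟ᴱ_ : ∀ {S} → DecidableEquality (Element S)
  u ≟ᴱ w = map′ element-≡ (cong proj₁) (proj₁ u ≟ᶠ proj₁ w)

module _ {n : ℕ} (G : Graph (Fin n)) where

  weaken : ∀ {S T} (S⊆T : S ⊆ T) {u w : Element S} → Walk (induced G S) u w →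
    Walk (induced G T) (proj₁ u , S⊆T (proj₂ u)) (proj₁ w , S⊆T (proj₂ w))
  weaken S⊆T stop       = stop
  weaken S⊆T (step e p) = step e (weaken S⊆T p)

  -- The vertex `x` serves as a hub: vertices of `C` reach it inside `C`, and `y` reaches it along
  -- the given edge.
  connected-∪⁅⁆ : ∀ {C x y} → Connected (induced G C) → x ∈ C → Adj G x y →
    Connected (induced G (C ∪ ⁅ y ⁆))
  connected-∪⁅⁆ {C} {x} {y} conn x∈C xy u w =
    proj₁ (shorten _≟ᴱ_ (proj₁ (append (toHub u) (proj₁ (reverse (toHub w))))))
    where
    D = C ∪ ⁅ y ⁆
    C⊆D : C ⊆ D
    C⊆D = p⊆p∪q ⁅ y ⁆
    toHub : (u : Element D) → Walk (induced G D) u (x , C⊆D x∈C)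
    toHub (u , u∈D) with x∈p∪q⁻ C ⁅ y ⁆ u∈D
    -- The walk given by `weaken` starts at the same vertex but carries another membership proof.
    ... | inj₁ u∈C = subst (λ u → Walk (induced G D) u (x , C⊆D x∈C)) (element-≡ refl)
                       (weaken C⊆D (proj₁ (conn (u , u∈C) (x , x∈C))))
    ... | inj₂ u∈y rewrite x∈⁅y⁆⇒x≡y y u∈y = step (adj-sym G xy) stop

  walk? : ∀ k u w → Dec (∃ λ (p : Walk G u w) → walkLength p ≡ k)
  walk? zero u w = map′ (λ { refl → stop , refl }) (λ { (stop , _) → refl }) (u ≟ᶠ w)
  walk? (suc k) u w = map′
    (λ { (x , e , p , eq) → step e p , cong suc eq })
    (λ { (step e p , eq) → _ , e , p , suc-injective eq })
    (any? λ x → adj? G u x ×-dec walk? k x w)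

-- The distance function of a connected graph.

module Distance {n : ℕ} (G : Graph (Fin n)) (connected : Connected G) where

  -- Minimising over walks instead of paths keeps the search decidable, by recursion on the length;
  -- a connecting path bounds it.
  shortest : ∀ u w → ∃ λ k → (∃ λ (p : Walk G u w) → walkLength p ≡ k) ×
    (∀ j → (∃ λ (p : Walk G u w) → walkLength p ≡ j) → k ≤ j)
  shortest u w = leastWitness (λ k → walk? G k u w) _ (proj₁ (connected u w) , refl)

  dist : Fin n → Fin n → ℕ
  dist u w = proj₁ (shortest u w)

  geodesic : ∀ u w → ∃ λ (p : Walk G u w) → walkLength p ≡ dist u w
  geodesic u w = proj₁ (proj₂ (shortest u w))

  dist-≤ : ∀ {u w} (p : Walk G u w) → dist u w ≤ walkLength p
  dist-≤ {u} {w} p = proj₂ (proj₂ (shortest u w)) _ (p , refl)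

  -- A shortest walk reduces to a path that is no longer, and every path is a walk, so both minima
  -- agree.
  isDistance : ∀ u w → IsDistance G u w (dist u w)
  isDistance u w with geodesic u w
  ... | p , eq with shorten _≟ᶠ_ p
  ...   | q , q≤p = (q , ≤-antisym (≤-trans q≤p (≤-reflexive eq)) (dist-≤ (proj₁ q))) ,
                    λ r → dist-≤ (proj₁ r)

  isDistance⇒≡ : ∀ {u w k} → IsDistance G u w k → k ≡ dist u w
  isDistance⇒≡ {u} {w} ((p , refl) , k≤) with isDistance u w
  ... | (q , eq) , d≤ = ≤-antisym (≤-trans (k≤ q) (≤-reflexive eq)) (d≤ p)

  ≢⇒resolves : ∀ {r x y} → dist r x ≢ dist r y → Resolves G r x y
  ≢⇒resolves ne = _ , _ , isDistance _ _ , isDistance _ _ , ne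

  resolves⇒≢ : ∀ {r x y} → Resolves G r x y → dist r x ≢ dist r y
  resolves⇒≢ (_ , _ , dx , dy , ne) eq =
    ne (trans (isDistance⇒≡ dx) (trans eq (sym (isDistance⇒≡ dy))))

  dist-triangle : ∀ u x w → dist u w ≤ dist u x + dist x w
  dist-triangle u x w with geodesic u x | geodesic x w
  ... | p , p≡ | q , q≡ with append p q
  ...   | r , r≡ rewrite sym p≡ | sym q≡ = ≤-trans (dist-≤ r) (≤-reflexive r≡)

  dist-sym : ∀ u w → dist u w ≡ dist w u
  dist-sym u w = ≤-antisym (half u w) (half w u)
    where
    half : ∀ u w → dist u w ≤ dist w u
    half u w with geodesic w u
    ... | p , p≡ with reverse p
    ...   | q , q≡ = ≤-trans (dist-≤ q) (≤-reflexive (trans q≡ p≡))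

  dist-refl : ∀ u → dist u u ≡ 0
  dist-refl u = n≤0⇒n≡0 (dist-≤ (stop {G = G} {u}))

  dist≡0⇒≡ : ∀ {u w} → dist u w ≡ 0 → u ≡ w
  dist≡0⇒≡ {u} {w} eq with geodesic u w
  ... | stop , _ = refl
  ... | step _ _ , eq′ with trans eq′ eq
  ...   | ()

  adj⇒dist≤ : ∀ v {x y} → Adj G x y → dist v y ≤ suc (dist v x)
  adj⇒dist≤ v {x} {y} xy with geodesic v x
  ... | p , p≡ with append p (step xy stop)
  ...   | q , q≡ = ≤-trans (dist-≤ q) (≤-reflexive (trans q≡ (trans (+-comm _ 1) (cong suc p≡))))

  adj⇒dist≡1 : ∀ {v x} → Adj G v x → dist v x ≡ 1
  adj⇒dist≡1 {v} {x} vx with dist v x in eq | dist-≤ (step vx stop)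
  ... | 0           | _ with dist≡0⇒≡ eq
  ...   | refl = contradiction vx (adj-irrefl G)
  adj⇒dist≡1 vx | 1 | _ = refl
  adj⇒dist≡1 vx | suc (suc _) | s≤s ()

  predecessor : ∀ v {x m} → dist v x ≡ suc m → ∃ λ y → Adj G y x × dist v y ≡ m
  -- The geodesic runs from `x` to `v`, so that the required neighbour is the end of its first step.
  predecessor v {x} {m} eq with geodesic x v
  ... | p , p≡ with trans p≡ (trans (dist-sym x v) eq)
  predecessor v {x} {m} eq | step {x = y} xy q , p≡ | q≡ =
    y , adj-sym G xy , ≤-antisym
      (≤-trans (≤-reflexive (dist-sym v y)) (≤-trans (dist-≤ q) (≤-reflexive (suc-injective q≡))))
      (≤-pred (≤-trans (≤-reflexive (sym eq)) (adj⇒dist≤ v (adj-sym G xy))))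

-- Components of G - v and distances through v.

module CutVertex {n : ℕ} (G : Graph (Fin n)) (connected : Connected G) (v : Fin n) where

  open Distance G connected

  module _ {C : Subset n} (comp : IsComponentOfDelete G v C) where

    ∈-component⇒≢ : ∀ {x} → x ∈ C → x ≢ v
    ∈-component⇒≢ x∈C refl = x∈∁p⇒x∉p (proj₁ comp x∈C) (x∈⁅x⁆ v)

    v∉component : v ∉ C
    v∉component v∈C = ∈-component⇒≢ v∈C refl

    -- By maximality: `C ∪ ⁅ y ⁆` is connected and avoids `v`. Hence a component can be left only
    -- through `v`.
    component-closed : ∀ {x y} → x ∈ C → Adj G x y → y ≢ v → y ∈ C
    component-closed {x} {y} x∈C xy y≢v =
      maximal (C ∪ ⁅ y ⁆) D⊆ (p⊆p∪q ⁅ y ⁆) (connected-∪⁅⁆ G conn x∈C xy)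
        (q⊆p∪q C ⁅ y ⁆ (x∈⁅x⁆ y))
      where
      C⊆ = proj₁ comp
      conn = proj₁ (proj₂ (proj₂ comp))
      maximal = proj₂ (proj₂ (proj₂ comp))
      D⊆ : C ∪ ⁅ y ⁆ ⊆ ∁ ⁅ v ⁆
      D⊆ z∈ with x∈p∪q⁻ C ⁅ y ⁆ z∈
      ... | inj₁ z∈C = C⊆ z∈C
      ... | inj₂ z∈y rewrite x∈⁅y⁆⇒x≡y y z∈y = x∉p⇒x∈∁p (y≢v ∘ x∈⁅y⁆⇒x≡y v)

    -- The walk is cut at its first visit to `v`; the vertex just before that visit is still in `C`
    -- and is the required neighbour.
    exit : ∀ {a x} → a ∈ C → x ∉ C → (p : Walk G a x) →
      (∃ λ y → y ∈ C × Adj G v y) ×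
      ∃ λ (q : Walk G a v) → ∃ λ (r : Walk G v x) → walkLength p ≡ walkLength q + walkLength r
    exit a∈C x∉C stop = contradiction a∈C x∉C
    exit {a} a∈C x∉C (step {x = y} e p) with y ≟ᶠ v
    ... | yes refl = (a , a∈C , adj-sym G e) , step e stop , p , refl
    ... | no y≢v with exit (component-closed a∈C e y≢v) x∉C p
    ...   | neighbour , q , r , eq = neighbour , step e q , r , cong suc eq

    neighbour-in-component : ∃ λ y → y ∈ C × Adj G v y
    neighbour-in-component =
      let (_ , (c , c∈C) , _) = comp in proj₁ (exit c∈C v∉component (proj₁ (connected c v)))

    dist-through : ∀ {a x} → a ∈ C → x ∉ C → dist a x ≡ dist a v + dist v x
    dist-through {a} {x} a∈C x∉C with geodesic a x
    ... | p , p≡ with exit a∈C x∉C p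
    ...   | _ , q , r , eq = ≤-antisym (dist-triangle a v x) (begin
      dist a v + dist v x           ≤⟨ +-mono-≤ (dist-≤ q) (dist-≤ r) ⟩
      walkLength q + walkLength r   ≡⟨ sym eq ⟩
      walkLength p                  ≡⟨ p≡ ⟩
      dist a x                      ∎)
      where open ≤-Reasoning

    dist-through′ : ∀ {r x} → r ∉ C → x ∈ C → dist r x ≡ dist r v + dist v x
    dist-through′ {r} {x} r∉C x∈C
      rewrite dist-sym r x | dist-through x∈C r∉C | dist-sym x v | dist-sym v r = +-comm (dist v x) (dist r v)

  -- A walk inside `A` never visits `v`, so once in `B` it stays in `B`.
  component-⊆ : ∀ {A B x} → IsComponentOfDelete G v A → IsComponentOfDelete G v B →
    x ∈ A → x ∈ B → A ⊆ B
  component-⊆ {A} {B} compA compB x∈A x∈B {y} y∈A =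
    follow (proj₁ (proj₁ (proj₂ (proj₂ compA)) (_ , x∈A) (y , y∈A))) x∈B
    where
    follow : ∀ {u w : Element A} → Walk (induced G A) u w → proj₁ u ∈ B → proj₁ w ∈ B
    follow stop u∈B = u∈B
    follow (step {x = z , z∈A} e p) u∈B =
      follow p (component-closed compB u∈B e (∈-component⇒≢ compA z∈A))

  components-disjoint : ∀ {A B x} → IsComponentOfDelete G v A → IsComponentOfDelete G v B →
    A ≢ B → x ∈ A → x ∉ B
  components-disjoint compA compB A≢B x∈A x∈B =
    A≢B (⊆-antisym (component-⊆ compA compB x∈A x∈B) (component-⊆ compB compA x∈B x∈A))

  -- Components on which the distance to v is injective.

  module _ {C : Subset n} (comp : IsComponentOfDelete G v C)
    (injective : ∀ {x y} → x ∈ C ∪ ⁅ v ⁆ → y ∈ C ∪ ⁅ v ⁆ → dist v x ≡ dist v y → x ≡ y) where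

    private
      S = C ∪ ⁅ v ⁆

      v∈S : v ∈ S
      v∈S = q⊆p∪q C ⁅ v ⁆ (x∈⁅x⁆ v)

      -- A predecessor other than `v` is adjacent to a vertex of `C`, hence in `C`; the case x = v
      -- is excluded by its distance 0.
      predecessor∈S : ∀ {x m} → x ∈ S → dist v x ≡ suc m → ∃ λ y → y ∈ S × Adj G y x × dist v y ≡ m
      predecessor∈S {x} x∈S eq with predecessor v eq
      ... | y , yx , y≡ with y ≟ᶠ v
      ...   | yes refl = v , v∈S , yx , y≡
      ...   | no y≢v with x∈p∪q⁻ C ⁅ v ⁆ x∈S
      ...     | inj₁ x∈C = y , p⊆p∪q ⁅ v ⁆ (component-closed comp x∈C (adj-sym G yx) y≢v) , yx , y≡
      ...     | inj₂ x∈v rewrite x∈⁅y⁆⇒x≡y v x∈v with trans (sym (dist-refl v)) eq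
      ...       | ()

      Level : ℕ → Set
      Level k = ∃ λ x → x ∈ S × dist v x ≡ k

      level? : ∀ k → Dec (Level k)
      level? k = any? λ x → (x ∈? S) ×-dec (dist v x ≟ k)

      level-down : ∀ {k} j → k ≤ j → Level j → Level k
      level-down j k≤j lev with m≤n⇒m<n∨m≡n k≤j
      ... | inj₂ refl = lev
      level-down (suc j) _ (x , x∈S , eq) | inj₁ (s≤s k≤j) with predecessor∈S x∈S eq
      ...   | y , y∈S , _ , y≡ = level-down j k≤j (y , y∈S , y≡)

      -- Distances are bounded, so some layer is empty. The first empty one is not layer 0, which
      -- contains `v`, and all layers before it are inhabited.
      lastLevel : ∃ λ K → (∀ j → j < suc K → Level j) × ¬ Level (suc K)
      lastLevel with bounded (dist v)
      ... | B , ≤B with leastWitness (¬? ∘ level?) (suc B)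
                         (λ (x , _ , eq) → 1+n≰n (≤-trans (≤-reflexive (sym eq)) (≤B x)))
      ...   | zero  , gap , _ = contradiction (v , v∈S , dist-refl v) gap
      ...   | suc K , gap , least =
              K , (λ j j<k → decidable-stable (level? j) λ ¬lev → 1+n≰n (≤-trans j<k (least j ¬lev))) , gap

    -- The distance from `v` is the isomorphism: layers 0 to `K` are the inhabited ones, and
    -- injectivity makes each a singleton.
    component-isomorphicToPath : IsomorphicToPath (induced G S)
    component-isomorphicToPath with lastLevel
    ... | K , level , gap = K , record
      { bijection = mk↔ₛ′ to from
          (λ i → toℕ-injective (trans (toℕ-to (from i)) (dist-from i)))
          (λ u → element-≡ (injective (proj₂ (from (to u))) (proj₂ u)
            (trans (dist-from (to u)) (toℕ-to u))))
      ; preserves = λ u w → mk⇔ (adj⇒ u w) (adj⇐ u w)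
      }
      where
      dist<1+K : (u : Element S) → dist v (proj₁ u) < suc K
      dist<1+K (x , x∈S) = ≰⇒> λ K<d → gap (level-down _ K<d (x , x∈S , refl))

      to : Element S → Fin (suc K)
      to u = fromℕ< (dist<1+K u)

      toℕ-to : ∀ u → toℕ (to u) ≡ dist v (proj₁ u)
      toℕ-to u = toℕ-fromℕ< (dist<1+K u)

      from : Fin (suc K) → Element S
      from i = let (x , x∈S , _) = level (toℕ i) (toℕ<n i) in x , x∈S

      dist-from : ∀ i → dist v (proj₁ (from i)) ≡ toℕ i
      dist-from i = proj₂ (proj₂ (level (toℕ i) (toℕ<n i)))

      adj⇒ : ∀ u w → Adj G (proj₁ u) (proj₁ w) → Adj (pathGraph K) (to u) (to w)
      adj⇒ u@(x , x∈S) w@(y , y∈S) xy rewrite toℕ-to u | toℕ-to w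
        with m≤n⇒m<n∨m≡n (adj⇒dist≤ v xy) | m≤n⇒m<n∨m≡n (adj⇒dist≤ v (adj-sym G xy))
      ... | inj₂ eq | _       = inj₁ eq
      ... | inj₁ _  | inj₂ eq = inj₂ eq
      -- The distances of adjacent vertices differ by at most one; were they equal, injectivity
      -- would turn the edge into a loop.
      ... | inj₁ lt | inj₁ gt with injective x∈S y∈S (≤-antisym (≤-pred gt) (≤-pred lt))
      ...   | refl = contradiction xy (adj-irrefl G)

      -- Some predecessor of `y` lies in the layer of `x`, and `x` is the only vertex there.
      adj-next : ∀ {x y} → x ∈ S → y ∈ S → dist v y ≡ suc (dist v x) → Adj G x y
      adj-next x∈S y∈S eq with predecessor∈S y∈S eq
      ... | z , z∈S , zy , z≡ with injective z∈S x∈S z≡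
      ...   | refl = zy

      adj⇐ : ∀ u w → Adj (pathGraph K) (to u) (to w) → Adj G (proj₁ u) (proj₁ w)
      adj⇐ u@(x , x∈S) w@(y , y∈S) adj rewrite toℕ-to u | toℕ-to w with adj
      ... | inj₁ eq = adj-next x∈S y∈S eq
      ... | inj₂ eq = adj-sym G (adj-next y∈S x∈S eq)

  -- Resolving sets and the components they meet.

  Meets : Subset n → Subset n → Set
  Meets R C = ∃ λ r → r ∈ R × r ∈ C

  meets? : ∀ R C → Dec (Meets R C)
  meets? R C = any? λ r → (r ∈? R) ×-dec (r ∈? C)

  module _ {R : Subset n} (resolving : IsResolvingSet G R) where

    missed⇒path : ∀ {C} → IsComponentOfDelete G v C → ¬ Meets R C →
      IsomorphicToPath (induced G (C ∪ ⁅ v ⁆))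
    missed⇒path {C} comp missed = component-isomorphicToPath comp λ {x} {y} x∈S y∈S eq →
      decidable-stable (x ≟ᶠ y) λ x≢y →
        let (r , r∈R , res) = resolving x y x≢y
        in resolves⇒≢ res (trans (through r∈R x∈S) (trans (cong (dist r v +_) eq) (sym (through r∈R y∈S))))
      where
      through : ∀ {r x} → r ∈ R → x ∈ C ∪ ⁅ v ⁆ → dist r x ≡ dist r v + dist v x
      through {r} r∈R x∈S with x∈p∪q⁻ C ⁅ v ⁆ x∈S
      ... | inj₁ x∈C = dist-through′ comp (λ r∈C → missed (r , r∈R , r∈C)) x∈C
      ... | inj₂ x∈v rewrite x∈⁅y⁆⇒x≡y v x∈v | dist-refl v = sym (+-identityʳ _)

    -- Neighbours of `v` in `A` and in `B` both have distance d(r,v) + 1 from every r in `R`, so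
    -- nothing in `R` separates them.
    not-both-missed : ∀ {A B} → IsComponentOfDelete G v A → IsComponentOfDelete G v B → A ≢ B →
      ¬ Meets R A → ¬ Meets R B → ⊥
    not-both-missed compA compB A≢B missA missB
      with neighbour-in-component compA | neighbour-in-component compB
    ... | x , x∈A , vx | y , y∈B , vy
      with resolving x y (λ { refl → components-disjoint compA compB A≢B x∈A y∈B })
    ...   | r , r∈R , res = resolves⇒≢ res
            (trans (dist-through′ compA (λ r∈A → missA (r , r∈R , r∈A)) x∈A)
              (trans (cong (dist r v +_) (trans (adj⇒dist≡1 vx) (sym (adj⇒dist≡1 vy))))
                (sym (dist-through′ compB (λ r∈B → missB (r , r∈R , r∈B)) y∈B))))

    remove-resolving : ∀ {A B} → IsComponentOfDelete G v A → IsComponentOfDelete G v B → A ≢ B →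
      Meets R A → Meets R B → IsResolvingSet G (R - v)
    remove-resolving {A} {B} compA compB A≢B (a , a∈R , a∈A) (b , b∈R , b∈B) x y x≢y
      with resolving x y x≢y
    ... | r , r∈R , res with r ≟ᶠ v
    ...   | no r≢v = r , x∈p∧x≢y⇒x∈p-y r∈R r≢v , res
    ...   | yes refl with dist a x ≟ dist a y | dist b x ≟ dist b y
    ...     | no a-res | _ = a , x∈p∧x≢y⇒x∈p-y a∈R (∈-component⇒≢ compA a∈A) , ≢⇒resolves a-res
    ...     | yes _ | no b-res = b , x∈p∧x≢y⇒x∈p-y b∈R (∈-component⇒≢ compB b∈B) , ≢⇒resolves b-res
    -- If neither `a` nor `b` separates the pair, then `v` does not either, against the choice of
    -- `r`.
    ...     | yes a≡ | yes b≡ =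
              contradiction (≤-antisym (half a≡ b≡) (half (sym a≡) (sym b≡))) (resolves⇒≢ res)
      where
      -- For `x` the distance from `c` splits exactly at `v`, for `y` the triangle inequality is
      -- used. Being one-sided, the bound also covers pairs in different components.
      compare : ∀ {C c x y} → IsComponentOfDelete G v C → c ∈ C → x ∉ C →
        dist c x ≡ dist c y → dist v x ≤ dist v y
      compare {c = c} {x} {y} comp c∈C x∉C eq = +-cancelˡ-≤ (dist c v) _ _ (begin
        dist c v + dist v x   ≡⟨ sym (dist-through comp c∈C x∉C) ⟩
        dist c x              ≡⟨ eq ⟩
        dist c y              ≤⟨ dist-triangle c v y ⟩
        dist c v + dist v y   ∎)
        where open ≤-Reasoning

      half : ∀ {x y} → dist a x ≡ dist a y → dist b x ≡ dist b y → dist v x ≤ dist v y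
      -- As `A` and `B` are disjoint, `x` lies outside one of them, which decides whether `a` or `b`
      -- is used.
      half {x} a≡ b≡ with x ∈? A
      ... | no  x∉A = compare compA a∈A x∉A a≡
      ... | yes x∈A = compare compB b∈B (components-disjoint compA compB A≢B x∈A) b≡

  meetsTwo⇒∉basis : ∀ {R A B} → IsMetricBasis G R →
    IsComponentOfDelete G v A → IsComponentOfDelete G v B → A ≢ B → Meets R A → Meets R B → v ∉ R
  meetsTwo⇒∉basis (resolving , _ , minimal) compA compB A≢B meetsA meetsB v∈R =
    1+n≰n (≤-trans (x∈p⇒∣p-x∣<∣p∣ v∈R)
      (minimal _ (remove-resolving resolving compA compB A≢B meetsA meetsB)))

  -- At most one of the three components is missed, so `R` meets two of them.
  threeComponents⇒void : AtLeastThreeComponents G v → IsVoidVertex G v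
  threeComponents⇒void (A , B , C , compA , compB , compC , A≢B , A≢C , B≢C) R basis@(resolving , _)
    with meets? R A | meets? R B | meets? R C
  ... | yes a | yes b | _     = meetsTwo⇒∉basis basis compA compB A≢B a b
  ... | yes a | no _  | yes c = meetsTwo⇒∉basis basis compA compC A≢C a c
  ... | no _  | yes b | yes c = meetsTwo⇒∉basis basis compB compC B≢C b c
  ... | no ¬a | no ¬b | _     = ⊥-elim (not-both-missed resolving compA compB A≢B ¬a ¬b)
  ... | no ¬a | yes _ | no ¬c = ⊥-elim (not-both-missed resolving compA compC A≢C ¬a ¬c)
  ... | yes _ | no ¬b | no ¬c = ⊥-elim (not-both-missed resolving compB compC B≢C ¬b ¬c)

  twoNonPathComponents⇒void : TwoNonPathComponents G v → IsVoidVertex G v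
  twoNonPathComponents⇒void (A , B , (compA , compB , A≢B , _) , ¬pathA , ¬pathB) R basis@(resolving , _) =
    meetsTwo⇒∉basis basis compA compB A≢B
      -- Not being a path only refutes that `R` misses the component; decidability then yields an
      -- element of `R` in it.
      (decidable-stable (meets? R A) (¬pathA ∘ missed⇒path resolving compA))
      (decidable-stable (meets? R B) (¬pathB ∘ missed⇒path resolving compB))

theorem1 : (n : ℕ) (G : Graph (Fin n)) → Connected G →
    (v : Fin n) → IsCutVertex G v →
    AtLeastThreeComponents G v ⊎ TwoNonPathComponents G v →
    IsVoidVertex G v
theorem1 n G connected v _ (inj₁ three) = CutVertex.threeComponents⇒void G connected v three
theorem1 n G connected v _ (inj₂ two)   = CutVertex.twoNonPathComponents⇒void G connected v two
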